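{- For all $n \geq 4$, \[\text{ex}(n,I_1)=\text{ex}_o(n,I_1) = n \left\lfloor \frac{n-1}{2} \right\rfloor,\] and there are \[\left(\frac{(n-1)!}{2^{\left\lfloor \frac{n-1}{2} \right\rfloor} \left \lfloor \frac{n-1}{2} \right\rfloor !}\right)^n\] labeled $I_1$-free $(2\to1)$-graphs (on the fixed vertex set $\{1,\dots,n\}$, not required to be oriented) that attain this maximum number of edges.
   Context: A $(2\to 1)$-graph (directed hypergraph) is a pair $H=(V,E)$ with $V$ a finite set and $E$ a set of pointed $3$-subsets of $V$: an edge, written $ab\to c$ (same as $ba\to c$), consists of three distinct vertices with head $c$ and tail set $\{a,b\}$. $H$ is oriented if every $3$-subset of $V$ carries at most one edge (in general it may carry up to three). $H$ is $F$-free if there is no injective map $\phi:V(F)\to V(H)$ such that $ab\to c\in E(F)$ implies $\phi(a)\phi(b)\to\phi(c)\in E(H)$. $\text{ex}(n,F)$ (resp. $\text{ex}_o(n,F)$) is the maximum number of edges of an $F$-free $(2\to1)$-graph (resp. $F$-free oriented $(2\to1)$-graph) on $n$ vertices. $I_1$ is the $(2\to1)$-graph with vertex set $\{a,b,c,d\}$ (four distinct vertices) and edges $ab\to c$, $ad\to c$. -}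

module Defs where

open import Data.Bool.Base using (Bool; true; false; T)
open import Data.Bool.Properties using (T?) renaming (_≟_ to _≟ᵇ_)
open import Data.Fin.Base using (Fin)
open import Data.Fin.Patterns using (0F; 1F; 2F; 3F)
open import Data.Fin.Properties using (_≟_; _<?_; all?)
open import Data.List.Base using (List; length; filter; allFin; cartesianProduct)
open import Data.Nat.Base as ℕ using (ℕ; _*_; _^_; _!; NonZero)
open import Data.Nat.Properties using (m*n≢0; m^n≢0; _!≢0)
open import Data.Product.Base using (Σ; ∃-syntax; _×_; _,_; proj₁)
open import Function.Base using (_on_)
open import Function.Bundles using (Inverse)
open import Function.Definitions using (Injective)
open import Level using (0ℓ)
open import Relation.Binary.Bundles using (Setoid)
open import Relation.Binary.PropositionalEquality using (_≡_; _≢_; refl; sym; trans; setoid)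
open import Relation.Nullary using (¬_)
open import Relation.Nullary.Decidable using (_×-dec_; _→-dec_; ¬?; from-yes)

-- A (2→1)-graph on the vertex set Fin n.  `edge? a b c` says whether ab→c is
-- an edge; symmetry in the tail makes ab→c and ba→c the same edge.
record DiHypergraph (n : ℕ) : Set where
  field
    edge?    : Fin n → Fin n → Fin n → Bool
    tail-sym : ∀ a b c → edge? a b c ≡ edge? b a c
    distinct : ∀ a b c → T (edge? a b c) → a ≢ b × a ≢ c × b ≢ c

  Edge : Fin n → Fin n → Fin n → Set
  Edge a b c = T (edge? a b c)

open DiHypergraph public

Oriented : ∀ {n} → DiHypergraph n → Set
Oriented G = ∀ a b c → Edge G a b c → ¬ Edge G a c b × ¬ Edge G b c a

-- Triples (c , a , b) stand for ab→c; requiring a < b lists each edge once.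
edges : ∀ {n} → DiHypergraph n → List (Fin n × Fin n × Fin n)
edges {n} G =
  filter (λ (c , a , b) → (a <? b) ×-dec T? (edge? G a b c))
         (cartesianProduct (allFin n) (cartesianProduct (allFin n) (allFin n)))

edgeCount : ∀ {n} → DiHypergraph n → ℕ
edgeCount G = length (edges G)

_Contains_ : ∀ {n m} → DiHypergraph n → DiHypergraph m → Set
_Contains_ {n} {m} H F =
  ∃[ φ ] Injective {A = Fin m} {B = Fin n} _≡_ _≡_ φ
       × (∀ a b c → Edge F a b c → Edge H (φ a) (φ b) (φ c))

_IsFreeOf_ : ∀ {n m} → DiHypergraph n → DiHypergraph m → Set
H IsFreeOf F = ¬ (H Contains F)

IsMaxEdgeCount : ∀ {n} → (DiHypergraph n → Set) → ℕ → Set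
IsMaxEdgeCount P k =
  (∃[ G ] P G × edgeCount G ≡ k) × (∀ G → P G → edgeCount G ℕ.≤ k)

-- ex(n,F) and exₒ(n,F) are given as relations, since the family of
-- F-free graphs can be empty (F without edges, on at most n vertices):
-- `Ex n F k` reads "ex(n,F) = k".
Ex : ∀ {m} → ℕ → DiHypergraph m → ℕ → Set
Ex n F = IsMaxEdgeCount {n} (λ G → G IsFreeOf F)

Exₒ : ∀ {m} → ℕ → DiHypergraph m → ℕ → Set
Exₒ n F = IsMaxEdgeCount {n} (λ G → Oriented G × G IsFreeOf F)

IsExtremal : ∀ {n m} → DiHypergraph m → DiHypergraph n → Set
IsExtremal {n} F G = G IsFreeOf F × Ex n F (edgeCount G)

-- Labelled graphs are equal when their edge sets are; no isomorphism is taken.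
_≈_ : ∀ {n} → DiHypergraph n → DiHypergraph n → Set
G ≈ H = ∀ a b c → edge? G a b c ≡ edge? H a b c

extremalGraphs : ∀ {m} → ℕ → DiHypergraph m → Setoid 0ℓ 0ℓ
extremalGraphs n F = record
  { Carrier       = Σ (DiHypergraph n) (IsExtremal F)
  ; _≈_           = _≈_ on proj₁
  ; isEquivalence = record
    { refl  = λ _ _ _ → refl
    ; sym   = λ p a b c → sym (p a b c)
    ; trans = λ p q a b c → trans (p a b c) (q a b c)
    }
  }

HasCardinality : Setoid 0ℓ 0ℓ → ℕ → Set
HasCardinality S k = Inverse S (setoid (Fin k))

-- I₁ has edges ab→c and ad→c, with a, b, c, d = 0, 1, 2, 3.
I₁-edge? : Fin 4 → Fin 4 → Fin 4 → Bool
I₁-edge? 0F 1F 2F = true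
I₁-edge? 1F 0F 2F = true
I₁-edge? 0F 3F 2F = true
I₁-edge? 3F 0F 2F = true
I₁-edge? _  _  _  = false

I₁ : DiHypergraph 4
I₁ = record { edge? = I₁-edge? ; tail-sym = sym′ ; distinct = distinct′ }
  where
  sym′ : ∀ a b c → I₁-edge? a b c ≡ I₁-edge? b a c
  sym′ = from-yes (all? λ a → all? λ b → all? λ c → I₁-edge? a b c ≟ᵇ I₁-edge? b a c)

  distinct′ : ∀ a b c → T (I₁-edge? a b c) → a ≢ b × a ≢ c × b ≢ c
  distinct′ = from-yes (all? λ a → all? λ b → all? λ c →
    T? (I₁-edge? a b c) →-dec (¬? (a ≟ b) ×-dec ¬? (a ≟ c) ×-dec ¬? (b ≟ c)))

-- Makes the natural-number division (n-1)! / (2 ^ k * k !) well-formed; for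
-- k = ⌊(n-1)/2⌋ that division is exact, so it agrees with the rational quotient.
2^k*k!≢0 : ∀ k → NonZero (2 ^ k * k !)
2^k*k!≢0 k = m*n≢0 (2 ^ k) (k !) {{m^n≢0 2 k}} {{k !≢0}}

{-# OPTIONS --safe #-}

-- In an I₁-free graph the tails of the edges with a given head c are pairwise
-- disjoint, so they form a matching of the other n − 1 vertices and there are
-- at most ⌊(n − 1)/2⌋ of them. Conversely the n matchings can be chosen
-- independently, so the extremal graphs are the families of n maximum
-- matchings. A matching is encoded as the involution exchanging matched
-- vertices, with c and the unmatched vertices as its fixed points; it is maximum
-- when at most one point other than c is fixed. For the oriented bound the
-- matchings are chosen so that no triple of vertices carries two edges.

module Submission where

open import Defs
open import Data.Nat using (ℕ; _≤_; _∸_; _*_; _^_; _/_; _!; ⌊_/2⌋)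
open import Data.Product using (_×_)

open import Algebra.Definitions using (Involutive)
import Algebra.Properties.CommutativeMonoid.Sum
open import Data.Bool.Base using (Bool; true; false; T; not; if_then_else_)
open import Data.Bool.Properties using (T?; not-involutive; ¬-not; not-¬) renaming (_≟_ to _≟ᵇ_)
open import Data.Fin.Base
  using (Fin; zero; suc; punchIn; _<_; fromℕ; inject₁; toℕ; combine; funToFin; finToFun)
open import Data.Fin.Patterns using (0F; 1F; 2F; 3F)
open import Data.Fin.Permutation using (permutation)
open import Data.Fin.Properties
  using (_≟_; _<?_; <-cmp; <⇒≢; any?; all?; suc-injective; punchInᵢ≢i; punchIn-injective;
         toℕ-inject₁; *↔×; +↔⊎; 1↔⊤; 2↔Bool; finToFun-funToFin; funToFin-finToFin)
open import Data.Fin.Relation.Unary.Top using (view; ‵fromℕ; ‵inject₁; view-fromℕ; view-inject₁)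
open import Data.List.Base
  using (List; []; _∷_; _++_; map; length; filter; tabulate; allFin; cartesianProduct)
open import Data.List.Properties using (map-++; map-∘)
open import Data.Nat.Base using (zero; suc; _+_; z≤n; s≤s)
open import Data.Nat.DivMod using (m*n/n≡m; _mod_)
import Data.Nat.ListAction as ℕ
open import Data.Nat.ListAction.Properties using (sum-++)
import Data.Nat.Properties as ℕ
open import Data.Nat.Tactic.RingSolver using (solve-∀)
open import Data.Product.Base using (Σ; ∃; _,_; proj₁; proj₂)
open import Data.Product.Function.NonDependent.Propositional using (_×-↔_)
open import Data.Product.Function.NonDependent.Setoid using (_×-inverse_)
open import Data.Product.Relation.Binary.Pointwise.NonDependent using (_×ₛ_; Pointwise-≡↔≡)
open import Data.Sum.Base using (_⊎_; inj₁; inj₂; [_,_])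
open import Data.Sum.Function.Propositional using (_⊎-↔_)
open import Data.Sum.Properties using (inj₂-injective)
open import Data.Unit.Base using (⊤; tt)
open import Function.Base using (_∘_; case_of_; const)
open import Function.Bundles using (Inverse; Injection; _↔_; _⇔_; mk⇔)
import Function.Construct.Composition as Compose
import Function.Construct.Identity as Identity
import Function.Construct.Symmetry as Symmetry
open import Function.Properties.Inverse using (Inverse⇒Injection)
open import Level using (0ℓ)
open import Relation.Binary.Bundles using (Setoid)
import Relation.Binary.Construct.On as On
open import Relation.Binary.Definitions using (tri<; tri≈; tri>)
open import Relation.Binary.PropositionalEquality
  using (_≡_; _≢_; _≗_; refl; sym; trans; cong; cong₂; subst; setoid; _→-setoid_; module ≡-Reasoning)
open import Relation.Nullary using (¬_; Dec; yes; no; does; contradiction)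
open import Relation.Nullary.Decidable
  using (_×-dec_; _→-dec_; ¬?; ⌊_⌋; isYes≗does; toWitness; fromWitness; does-⇔;
         dec-true; dec-false; decidable-stable; from-yes)
open import Relation.Unary using (Pred; Decidable)

open Algebra.Properties.CommutativeMonoid.Sum ℕ.+-0-commutativeMonoid
  using (sum; sum-cong-≗; sum-remove; ∑-distrib-+; sum-permute; sum-replicate-zero)

-- The count rests on a recursion: deleting one point of a perfect matching of 2k + 2 points leaves
-- its mate as the only fixed point, which can be any of the remaining 2k + 1. So there are (2k -
-- 1)!! perfect matchings of 2k points, and both parities of n - 1 lead to the same quotient of
-- factorials. The obstacle is orientedness. For even n one vertex besides the head may stay
-- unmatched, so all heads can share one perfect matching of the vertex set, each head leaving its
-- own twin over; the head of an edge is then the vertex of the triple outside the pair of twins.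
-- For odd n nothing may be left over and the twin of the head has to be rematched. The (n - 1)/2
-- pairs are put on a cycle and the two members of a pair borrow from opposite neighbours. The cycle
-- must have length at least 3, so n = 5 is separate. The rule a + b = 2c in ℤ/n, used there, is no
-- general substitute: two edges on one triple mean 3(b - c) = 0, which has nonzero solutions when 3
-- divides n.

private variable
  n : ℕ
  A B : Set
  P : Pred (Fin n) 0ℓ

-- Counting

𝟙 : Dec A → ℕ
𝟙 A? = if does A? then 1 else 0

𝟙-cong : A ⇔ B → (A? : Dec A) (B? : Dec B) → 𝟙 A? ≡ 𝟙 B?
𝟙-cong A⇔B A? B? = cong (λ b → if b then 1 else 0) (does-⇔ A⇔B A? B?)

𝟙-yes : (A? : Dec A) → A → 𝟙 A? ≡ 1
𝟙-yes A? a rewrite dec-true A? a = refl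

𝟙-no : (A? : Dec A) → ¬ A → 𝟙 A? ≡ 0
𝟙-no A? ¬a rewrite dec-false A? ¬a = refl

sum-zero : {t : Fin n → ℕ} → (∀ i → t i ≡ 0) → sum t ≡ 0
sum-zero {n} t≗0 = trans (sum-cong-≗ t≗0) (sum-replicate-zero n)

sum-single : (t : Fin n → ℕ) (i : Fin n) → (∀ j → j ≢ i → t j ≡ 0) → sum t ≡ t i
sum-single {suc n} t i others =
  trans (sum-remove {i = i} t)
        (trans (cong (t i +_) (sum-zero λ j → others (punchIn i j) (punchInᵢ≢i i j)))
               (ℕ.+-identityʳ _))

sum-≤ : {t : Fin n → ℕ} {k : ℕ} → (∀ i → t i ≤ k) → sum t ≤ n * k
sum-≤ {zero}  t≤k = z≤n
sum-≤ {suc n} t≤k = ℕ.+-mono-≤ (t≤k zero) (sum-≤ (t≤k ∘ suc))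

-- One short term could not be made up for by the others, all bounded by the same k. This passes
-- extremality from a graph to each of its links.
sum-maximal⇒maximal : {t : Fin n → ℕ} {k : ℕ} → (∀ i → t i ≤ k) →
                      sum t ≡ n * k → ∀ i → t i ≡ k
sum-maximal⇒maximal {suc n} {t} {k} t≤k eq = λ where
    zero    → t₀≡k
    (suc i) → sum-maximal⇒maximal (t≤k ∘ suc) (ℕ.+-cancelˡ-≡ k _ _ (trans (cong (_+ _) (sym t₀≡k)) eq)) i
  where
  t₀≡k : t zero ≡ k
  t₀≡k = ℕ.≤-antisym (t≤k zero) (ℕ.≮⇒≥ λ t₀<k →
    ℕ.<-irrefl eq (ℕ.+-mono-<-≤ t₀<k (sum-≤ (t≤k ∘ suc))))

sum-const : ∀ n k → sum {n} (λ _ → k) ≡ n * k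
sum-const zero    k = refl
sum-const (suc n) k = cong (k +_) (sum-const n k)

count : {P : Pred (Fin n) 0ℓ} → Decidable P → ℕ
count P? = sum λ i → 𝟙 (P? i)

count-∅ : (P? : Decidable P) → (∀ i → ¬ P i) → count P? ≡ 0
count-∅ P? ¬P = sum-zero λ i → 𝟙-no (P? i) (¬P i)

count≢0⇒∃ : (P? : Decidable P) → count P? ≢ 0 → ∃ P
count≢0⇒∃ P? c≢0 = decidable-stable (any? P?) λ ¬∃ → c≢0 (count-∅ P? λ i p → ¬∃ (i , p))

∃⇒count>0 : ∀ {n} {P : Pred (Fin n) 0ℓ} (P? : Decidable P) {i} → P i → 1 ≤ count P?
∃⇒count>0 {n = suc n} P? {i} p = ℕ.≤-trans
  (ℕ.≤-reflexive (sym (𝟙-yes (P? i) p)))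
  (ℕ.≤-trans (ℕ.m≤m+n _ _) (ℕ.≤-reflexive (sym (sum-remove {i = i} (λ j → 𝟙 (P? j))))))

count≤1⇒unique : ∀ {n} {P : Pred (Fin n) 0ℓ} (P? : Decidable P) →
                 count P? ≤ 1 → ∀ {i j} → P i → P j → i ≡ j
count≤1⇒unique {suc n} {P} P? c≤1 = go
  where
  ¬both : ∀ {j} → P zero → ¬ P (suc j)
  ¬both p q = ℕ.<⇒≱ (subst (λ m → 2 ≤ m + count (P? ∘ suc)) (sym (𝟙-yes (P? zero) p))
                           (s≤s (∃⇒count>0 (P? ∘ suc) q))) c≤1

  go : ∀ {i j} → P i → P j → i ≡ j
  go {zero}  {zero}  p q = refl
  go {zero}  {suc j} p q = contradiction q (¬both p)
  go {suc i} {zero}  p q = contradiction p (¬both q)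
  go {suc i} {suc j} p q = cong suc (count≤1⇒unique (P? ∘ suc) (ℕ.≤-trans (ℕ.m≤n+m _ _) c≤1) p q)

unique⇒count≤1 : ∀ {n} {P : Pred (Fin n) 0ℓ} (P? : Decidable P) →
                 (∀ {i j} → P i → P j → i ≡ j) → count P? ≤ 1
unique⇒count≤1 P? unique with any? P?
... | no ¬∃ = ℕ.≤-trans (ℕ.≤-reflexive (count-∅ P? λ i p → ¬∃ (i , p))) z≤n
... | yes (i , p) = ℕ.≤-reflexive (trans
  (sum-single _ i λ j j≢i → 𝟙-no (P? j) λ q → j≢i (unique q p)) (𝟙-yes (P? i) p))

Fixed? : (f : Fin n → Fin n) → Decidable (λ x → f x ≡ x)
Fixed? f x = f x ≟ x

-- A 2-cycle of an involution has exactly one such point, its smaller one, so this is the number of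
-- matched pairs; it agrees with the convention a < b in `edges`.
excedances : (Fin n → Fin n) → ℕ
excedances f = count (λ x → x <? f x)

-- An involution exchanges the points it moves up with those it moves down.
n≡2*excedances+fixed : (f : Fin n → Fin n) → Involutive _≡_ f →
  n ≡ excedances f + excedances f + count (Fixed? f)
n≡2*excedances+fixed {n} f inv = begin
  n                                                          ≡⟨ ℕ.*-identityʳ n ⟨
  n * 1                                                      ≡⟨ sum-const n 1 ⟨
  sum {n} (λ _ → 1)                                          ≡⟨ sum-cong-≗ trichotomy ⟩
  sum (λ x → 𝟙 (x <? f x) + 𝟙 (f x <? x) + 𝟙 (f x ≟ x))
    ≡⟨ ∑-distrib-+ (λ x → 𝟙 (x <? f x) + 𝟙 (f x <? x)) _ ⟩
  sum (λ x → 𝟙 (x <? f x) + 𝟙 (f x <? x)) + count (Fixed? f)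
    ≡⟨ cong (_+ count (Fixed? f)) (∑-distrib-+ _ (λ x → 𝟙 (f x <? x))) ⟩
  excedances f + count (λ x → f x <? x) + count (Fixed? f)
    ≡⟨ cong (λ m → excedances f + m + count (Fixed? f)) deficits ⟩
  excedances f + excedances f + count (Fixed? f)             ∎
  where
  open ≡-Reasoning
  trichotomy : ∀ x → 1 ≡ 𝟙 (x <? f x) + 𝟙 (f x <? x) + 𝟙 (f x ≟ x)
  trichotomy x with <-cmp x (f x)
  ... | tri< a b c rewrite 𝟙-yes (x <? f x) a | 𝟙-no (f x <? x) c | 𝟙-no (f x ≟ x) (b ∘ sym) = refl
  ... | tri≈ a b c rewrite 𝟙-no (x <? f x) a | 𝟙-no (f x <? x) c | 𝟙-yes (f x ≟ x) (sym b) = refl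
  ... | tri> a b c rewrite 𝟙-no (x <? f x) a | 𝟙-yes (f x <? x) c | 𝟙-no (f x ≟ x) (b ∘ sym) = refl

  deficits : count (λ x → f x <? x) ≡ excedances f
  deficits = trans (sum-permute _ (permutation f f inv inv))
    (sum-cong-≗ λ x → 𝟙-cong (mk⇔ (subst (_< f x) (inv x)) (subst (_< f x) (sym (inv x))))
                             (f (f x) <? f x) (x <? f x))

m≡e+e+r⇒e≤⌊m/2⌋ : ∀ {m} e r → m ≡ e + e + r → e ≤ ⌊ m /2⌋
m≡e+e+r⇒e≤⌊m/2⌋ e r refl =
  subst (_≤ ⌊ e + e + r /2⌋) (sym (ℕ.n≡⌊n+n/2⌋ e)) (ℕ.⌊n/2⌋-mono (ℕ.m≤m+n (e + e) r))

r≤1⇒e≡⌊m/2⌋ : ∀ {m} e r → m ≡ e + e + r → r ≤ 1 → e ≡ ⌊ m /2⌋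
r≤1⇒e≡⌊m/2⌋ e zero refl _ = trans (ℕ.n≡⌊n+n/2⌋ e) (cong ⌊_/2⌋ (sym (ℕ.+-identityʳ (e + e))))
r≤1⇒e≡⌊m/2⌋ e (suc zero) refl _ = trans (ℕ.n≡⌈n+n/2⌉ e) (cong ⌊_/2⌋ (sym (ℕ.+-comm (e + e) 1)))
r≤1⇒e≡⌊m/2⌋ e (suc (suc _)) _ (s≤s ())

-- Two leftover points would make room for another pair, so the half of m would be at least e + 1.
e≡⌊m/2⌋⇒r≤1 : ∀ {m} e r → m ≡ e + e + r → e ≡ ⌊ m /2⌋ → r ≤ 1
e≡⌊m/2⌋⇒r≤1 e zero _ _ = z≤n
e≡⌊m/2⌋⇒r≤1 e (suc zero) _ _ = s≤s z≤n
e≡⌊m/2⌋⇒r≤1 e (suc (suc r)) refl eq = contradiction eq (ℕ.<⇒≢ (ℕ.≤-trans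
  (s≤s (ℕ.≤-trans (ℕ.≤-reflexive (ℕ.n≡⌊n+n/2⌋ e)) (ℕ.⌊n/2⌋-mono (ℕ.m≤m+n (e + e) r))))
  (ℕ.≤-reflexive (cong ⌊_/2⌋ (sym (trans (ℕ.+-suc (e + e) (suc r)) (cong suc (ℕ.+-suc (e + e) r))))))))

record MaximumMatching (c : Fin n) (f : Fin n → Fin n) : Set where
  field
    involutive : Involutive _≡_ f
    avoids     : f c ≡ c
    maximum    : ∀ {x y} → x ≢ c → y ≢ c → f x ≡ x → f y ≡ y → x ≡ y

punchIn-view : (c x : Fin (suc n)) → x ≡ c ⊎ ∃ λ y → x ≡ punchIn c y
punchIn-view zero zero = inj₁ refl
punchIn-view zero (suc x) = inj₂ (x , refl)
punchIn-view {suc n} (suc c) zero = inj₂ (zero , refl)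
punchIn-view {suc n} (suc c) (suc x) with punchIn-view c x
... | inj₁ refl = inj₁ refl
... | inj₂ (y , refl) = inj₂ (suc y , refl)

module _ {n : ℕ} {c : Fin (suc n)} (f : Fin (suc n) → Fin (suc n)) (inv : Involutive _≡_ f) (fc≡c : f c ≡ c) where

  Unmatched? : Decidable (λ y → f (punchIn c y) ≡ punchIn c y)
  Unmatched? y = Fixed? f (punchIn c y)

  -- The head c is itself a fixed point; splitting it off cancels one of the `suc n` vertices and
  -- leaves those available for tails.
  n≡2*excedances+unmatched : n ≡ excedances f + excedances f + count Unmatched?
  n≡2*excedances+unmatched = ℕ.suc-injective (begin
    suc n                                              ≡⟨ n≡2*excedances+fixed f inv ⟩
    2e + count (Fixed? f)
      ≡⟨ cong (2e +_) (sum-remove {i = c} (λ x → 𝟙 (Fixed? f x))) ⟩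
    2e + (𝟙 (f c ≟ c) + count Unmatched?)
      ≡⟨ cong (λ m → 2e + (m + count Unmatched?)) (𝟙-yes (f c ≟ c) fc≡c) ⟩
    2e + suc (count Unmatched?)                        ≡⟨ ℕ.+-suc 2e _ ⟩
    suc (2e + count Unmatched?)                        ∎)
    where
    open ≡-Reasoning
    2e = excedances f + excedances f

  excedances≤ : excedances f ≤ ⌊ n /2⌋
  excedances≤ = m≡e+e+r⇒e≤⌊m/2⌋ _ _ n≡2*excedances+unmatched

  excedances≡⇒maximum : excedances f ≡ ⌊ n /2⌋ → MaximumMatching c f
  excedances≡⇒maximum e≡ = record { involutive = inv ; avoids = fc≡c ; maximum = maximum _ _ }
    where
    maximum : ∀ x y → x ≢ c → y ≢ c → f x ≡ x → f y ≡ y → x ≡ y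
    maximum x y x≢c y≢c fx fy with punchIn-view c x | punchIn-view c y
    ... | inj₁ x≡c | _ = contradiction x≡c x≢c
    ... | inj₂ _ | inj₁ y≡c = contradiction y≡c y≢c
    ... | inj₂ (_ , refl) | inj₂ (_ , refl) = cong (punchIn c)
      (count≤1⇒unique Unmatched? (e≡⌊m/2⌋⇒r≤1 _ _ n≡2*excedances+unmatched e≡) fx fy)

maximum⇒excedances≡ : {c : Fin (suc n)} {f : Fin (suc n) → Fin (suc n)} →
                      MaximumMatching c f → excedances f ≡ ⌊ n /2⌋
maximum⇒excedances≡ {c = c} {f} M = r≤1⇒e≡⌊m/2⌋ _ _ (n≡2*excedances+unmatched f involutive avoids)
  (unique⇒count≤1 (Unmatched? f involutive avoids) λ fx fy →
    punchIn-injective c _ _ (maximum (punchInᵢ≢i c _) (punchInᵢ≢i c _) fx fy))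
  where open MaximumMatching M

-- Links of I₁-free graphs as involutions

T⇒≡ : ∀ {x y} → T x ⇔ T y → x ≡ y
T⇒≡ x⇔y = does-⇔ x⇔y (T? _) (T? _)

length-filter : {P : Pred A 0ℓ} (P? : Decidable P) (xs : List A) →
                length (filter P? xs) ≡ ℕ.sum (map (λ x → 𝟙 (P? x)) xs)
length-filter P? []       = refl
length-filter P? (x ∷ xs) with does (P? x)
... | true  = cong suc (length-filter P? xs)
... | false = length-filter P? xs

sum-cartesianProduct : (f : A × B → ℕ) (xs : List A) (ys : List B) →
  ℕ.sum (map f (cartesianProduct xs ys)) ≡ ℕ.sum (map (λ x → ℕ.sum (map (λ y → f (x , y)) ys)) xs)
sum-cartesianProduct f []       ys = refl
sum-cartesianProduct f (x ∷ xs) ys = begin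
  ℕ.sum (map f (map (x ,_) ys ++ cartesianProduct xs ys))
    ≡⟨ cong ℕ.sum (map-++ f (map (x ,_) ys) _) ⟩
  ℕ.sum (map f (map (x ,_) ys) ++ map f (cartesianProduct xs ys))
    ≡⟨ sum-++ (map f (map (x ,_) ys)) _ ⟩
  ℕ.sum (map f (map (x ,_) ys)) + ℕ.sum (map f (cartesianProduct xs ys))
    ≡⟨ cong₂ _+_ (cong ℕ.sum (sym (map-∘ ys))) (sum-cartesianProduct f xs ys) ⟩
  ℕ.sum (map (λ y → f (x , y)) ys) + ℕ.sum (map (λ x → ℕ.sum (map (λ y → f (x , y)) ys)) xs) ∎
  where open ≡-Reasoning

sum-tabulate : (f : A → ℕ) (g : Fin n → A) → ℕ.sum (map f (tabulate g)) ≡ sum (f ∘ g)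
sum-tabulate {n = zero}  f g = refl
sum-tabulate {n = suc n} f g = cong (f (g zero) +_) (sum-tabulate f (g ∘ suc))

sum-triples : (t : Fin n × Fin n × Fin n → ℕ) →
  ℕ.sum (map t (cartesianProduct (allFin n) (cartesianProduct (allFin n) (allFin n))))
    ≡ sum λ c → sum λ a → sum λ b → t (c , a , b)
sum-triples {n} t = begin
  ℕ.sum (map t (cartesianProduct V (cartesianProduct V V)))
    ≡⟨ sum-cartesianProduct t V (cartesianProduct V V) ⟩
  ℕ.sum (map (λ c → ℕ.sum (map (λ ab → t (c , ab)) (cartesianProduct V V))) V)
    ≡⟨ sum-tabulate {n = n} _ _ ⟩
  sum (λ c → ℕ.sum (map (λ ab → t (c , ab)) (cartesianProduct V V)))
    ≡⟨ sum-cong-≗ {n} (λ c → sum-cartesianProduct (λ ab → t (c , ab)) V V) ⟩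
  sum (λ c → ℕ.sum (map (λ a → ℕ.sum (map (λ b → t (c , a , b)) V)) V))
    ≡⟨ sum-cong-≗ {n} (λ c → sum-tabulate {n = n} _ _) ⟩
  sum (λ c → sum λ a → ℕ.sum (map (λ b → t (c , a , b)) V))
    ≡⟨ sum-cong-≗ {n} (λ c → sum-cong-≗ {n} λ a → sum-tabulate {n = n} _ _) ⟩
  sum (λ c → sum λ a → sum λ b → t (c , a , b)) ∎
  where
  open ≡-Reasoning
  V = allFin n

MatchingLinks : DiHypergraph n → Set
MatchingLinks G = ∀ {a b d c} → Edge G a b c → Edge G a d c → b ≡ d

quadruple : (a b c d : Fin n) → Fin 4 → Fin n
quadruple a b c d 0F = a
quadruple a b c d 1F = b
quadruple a b c d 2F = c
quadruple a b c d 3F = d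

quadruple-injective : ∀ {a b c d : Fin n} → a ≢ b → a ≢ c → a ≢ d → b ≢ c → b ≢ d → d ≢ c →
                      ∀ {i j} → quadruple a b c d i ≡ quadruple a b c d j → i ≡ j
quadruple-injective a≢b a≢c a≢d b≢c b≢d d≢c = go _ _
  where
  go : ∀ i j → quadruple _ _ _ _ i ≡ quadruple _ _ _ _ j → i ≡ j
  go 0F 0F _ = refl
  go 0F 1F p = contradiction p a≢b
  go 0F 2F p = contradiction p a≢c
  go 0F 3F p = contradiction p a≢d
  go 1F 0F p = contradiction (sym p) a≢b
  go 1F 1F _ = refl
  go 1F 2F p = contradiction p b≢c
  go 1F 3F p = contradiction p b≢d
  go 2F 0F p = contradiction (sym p) a≢c
  go 2F 1F p = contradiction (sym p) b≢c
  go 2F 2F _ = refl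
  go 2F 3F p = contradiction (sym p) d≢c
  go 3F 0F p = contradiction (sym p) a≢d
  go 3F 1F p = contradiction (sym p) b≢d
  go 3F 2F p = contradiction p d≢c
  go 3F 3F _ = refl

I₁-free⇒matchingLinks : (G : DiHypergraph n) → G IsFreeOf I₁ → MatchingLinks G
I₁-free⇒matchingLinks {n} G free {a} {b} {d} {c} ab→c ad→c = decidable-stable (b ≟ d) λ b≢d →
  let a≢b , a≢c , b≢c = distinct G a b c ab→c
      a≢d , _   , d≢c = distinct G a d c ad→c
  in free (quadruple a b c d , quadruple-injective a≢b a≢c a≢d b≢c b≢d d≢c , λ where
       0F 1F 2F _ → ab→c
       1F 0F 2F _ → subst T (tail-sym G a b c) ab→c
       0F 3F 2F _ → ad→c
       3F 0F 2F _ → subst T (tail-sym G a d c) ad→c)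

matchingLinks⇒I₁-free : (G : DiHypergraph n) → MatchingLinks G → G IsFreeOf I₁
matchingLinks⇒I₁-free G links (φ , φ-injective , φ-edge) =
  -- The images of 1 and 3 are both joined to φ 0 under the head φ 2, so they coincide, against
  -- injectivity.
  case φ-injective (links (φ-edge 0F 1F 2F _) (φ-edge 0F 3F 2F _)) of λ ()

-- `partner G c a` is the vertex b with ab→c, and a itself when there is none.
partner : DiHypergraph n → Fin n → Fin n → Fin n
partner G c a with any? (λ b → T? (edge? G a b c))
... | yes (b , _) = b
... | no  _       = a

edge⇒≢ : (G : DiHypergraph n) → ∀ {a b c} → Edge G a b c → a ≢ b
edge⇒≢ G e = proj₁ (distinct G _ _ _ e)

partner≢⇒edge : (G : DiHypergraph n) → ∀ {a c} → partner G c a ≢ a → Edge G a (partner G c a) c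
partner≢⇒edge G {a} {c} p≢a with any? (λ b → T? (edge? G a b c))
... | yes (_ , e) = e
... | no  _       = contradiction refl p≢a

partner-avoids : (G : DiHypergraph n) → ∀ c → partner G c c ≡ c
partner-avoids G c = decidable-stable (partner G c c ≟ c) λ p≢c →
  proj₁ (proj₂ (distinct G c _ c (partner≢⇒edge G p≢c))) refl

module _ {n : ℕ} (G : DiHypergraph n) (links : MatchingLinks G) where

  edge⇒partner≡ : ∀ {a b c} → Edge G a b c → partner G c a ≡ b
  edge⇒partner≡ {a} {b} {c} e with any? (λ b → T? (edge? G a b c))
  ... | yes (_ , e′) = links e′ e
  ... | no  ¬e       = contradiction (b , e) ¬e

  partner-involutive : ∀ c → Involutive _≡_ (partner G c)
  partner-involutive c a with partner G c a ≟ a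
  ... | yes p≡a = trans (cong (partner G c) p≡a) p≡a
  ... | no  p≢a = edge⇒partner≡ (subst T (tail-sym G _ _ _) (partner≢⇒edge G p≢a))

  partner⇔edge : ∀ {a b c} → (partner G c a ≡ b × a ≢ b) ⇔ Edge G a b c
  partner⇔edge = mk⇔ (λ { (refl , a≢b) → partner≢⇒edge G (a≢b ∘ sym) })
                     (λ e → edge⇒partner≡ e , edge⇒≢ G e)

  -- For fixed c and a only b = `partner G c a` can complete an edge, and it is listed exactly when
  -- a is the smaller end.
  edgeCount≡ : edgeCount G ≡ sum (λ c → excedances (partner G c))
  edgeCount≡ = begin
    edgeCount G
      ≡⟨ length-filter edge-increasing? (cartesianProduct V (cartesianProduct V V)) ⟩
    ℕ.sum (map (λ e → 𝟙 (edge-increasing? e)) (cartesianProduct V (cartesianProduct V V)))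
      ≡⟨ sum-triples (λ e → 𝟙 (edge-increasing? e)) ⟩
    sum (λ c → sum λ a → sum λ b → 𝟙 (edge-increasing? (c , a , b)))
      ≡⟨ sum-cong-≗ {n} (λ c → sum-cong-≗ {n} (outdegree c)) ⟩
    sum (λ c → excedances (partner G c)) ∎
    where
    open ≡-Reasoning
    V = allFin n

    edge-increasing? : Decidable (λ ((c , a , b) : Fin n × Fin n × Fin n) → a < b × Edge G a b c)
    edge-increasing? (c , a , b) = (a <? b) ×-dec T? (edge? G a b c)

    outdegree : ∀ c a → sum (λ b → 𝟙 (edge-increasing? (c , a , b))) ≡ 𝟙 (a <? partner G c a)
    outdegree c a = trans
      (sum-single _ (partner G c a) λ b b≢p →
        𝟙-no (edge-increasing? (c , a , b)) λ (_ , e) → b≢p (sym (edge⇒partner≡ e)))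
      (𝟙-cong (mk⇔ proj₁ λ a<p → a<p , partner≢⇒edge G (<⇒≢ a<p ∘ sym))
              (edge-increasing? (c , a , partner G c a)) (a <? partner G c a))

module _ {n : ℕ} (F : Fin n → Fin n → Fin n)
         (inv : ∀ c → Involutive _≡_ (F c)) (avoids : ∀ c → F c c ≡ c) where

  private
    joined? : ∀ c a b → Dec (F c a ≡ b × a ≢ b)
    joined? c a b = (F c a ≟ b) ×-dec ¬? (a ≟ b)

    joined-sym : ∀ {c a b} → F c a ≡ b × a ≢ b → F c b ≡ a × b ≢ a
    joined-sym (refl , a≢b) = inv _ _ , a≢b ∘ sym

  -- Fixed points stand for unmatched vertices and must not become edges, hence the conjunct a ≢ b
  -- in `joined?`.
  fromLinks : DiHypergraph n
  fromLinks = record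
    { edge?    = λ a b c → ⌊ joined? c a b ⌋
    ; tail-sym = λ a b c → T⇒≡ (mk⇔
        (λ e → fromWitness (joined-sym (toWitness e)))
        λ e → fromWitness (joined-sym (toWitness e)))
    ; distinct = λ a b c e → let Fa≡b , a≢b = toWitness e in
        a≢b ,
        (λ { refl → a≢b (trans (sym (avoids c)) Fa≡b) }) ,
        -- If b were c, applying F c to F c a = c would give a = c = b.
        (λ { refl → a≢b (trans (sym (inv c a)) (trans (cong (F c) Fa≡b) (avoids c))) })
    }

  fromLinks-edge : ∀ {a b c} → Edge fromLinks a b c → F c a ≡ b × a ≢ b
  fromLinks-edge = toWitness

  fromLinks-matchingLinks : MatchingLinks fromLinks
  fromLinks-matchingLinks e e′ = trans (sym (proj₁ (toWitness e))) (proj₁ (toWitness e′))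

  partner-fromLinks : ∀ c → partner fromLinks c ≗ F c
  partner-fromLinks c a with F c a ≟ a | partner fromLinks c a ≟ a
  ... | no  Fa≢a | _       = edge⇒partner≡ fromLinks fromLinks-matchingLinks (fromWitness (refl , Fa≢a ∘ sym))
  ... | yes Fa≡a | yes p≡a = trans p≡a (sym Fa≡a)
  ... | yes Fa≡a | no  p≢a = sym (proj₁ (toWitness (partner≢⇒edge fromLinks p≢a)))

fromLinks-partner : (G : DiHypergraph n) (links : MatchingLinks G) →
                    fromLinks (partner G) (partner-involutive G links) (partner-avoids G) ≈ G
fromLinks-partner G links a b c = trans (isYes≗does _)
  (does-⇔ (partner⇔edge G links) ((partner G c a ≟ b) ×-dec ¬? (a ≟ b)) (T? _))

edgeCount≤ : (G : DiHypergraph (suc n)) → MatchingLinks G → edgeCount G ≤ suc n * ⌊ n /2⌋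
edgeCount≤ G links = subst (_≤ _) (sym (edgeCount≡ G links)) (sum-≤ λ c →
  excedances≤ (partner G c) (partner-involutive G links c) (partner-avoids G c))

edgeCount≡⇒maximum : (G : DiHypergraph (suc n)) → MatchingLinks G → edgeCount G ≡ suc n * ⌊ n /2⌋ →
                     ∀ c → MaximumMatching c (partner G c)
edgeCount≡⇒maximum {n} G links G-max c = excedances≡⇒maximum (partner G c) (inv c) (partner-avoids G c)
  (sum-maximal⇒maximal (λ c → excedances≤ (partner G c) (inv c) (partner-avoids G c))
                       (trans (sym (edgeCount≡ G links)) G-max) c)
  where inv = partner-involutive G links

maximum⇒edgeCount≡ : (G : DiHypergraph (suc n)) → MatchingLinks G → (∀ c → MaximumMatching c (partner G c)) →
                     edgeCount G ≡ suc n * ⌊ n /2⌋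
maximum⇒edgeCount≡ {n} G links maximum = trans (edgeCount≡ G links)
  (trans (sum-cong-≗ {suc n} λ c → maximum⇒excedances≡ (maximum c)) (sum-const (suc n) ⌊ n /2⌋))

-- Enumeration of maximum matchings

mkInverse : {S T : Setoid 0ℓ 0ℓ} (let module S = Setoid S) (let module T = Setoid T)
            (to : S.Carrier → T.Carrier) (from : T.Carrier → S.Carrier) →
            (∀ {x y} → x S.≈ y → to x T.≈ to y) → (∀ {x y} → x T.≈ y → from x S.≈ from y) →
            (∀ y → to (from y) T.≈ y) → (∀ x → from (to x) S.≈ x) → Inverse S T
mkInverse {S} {T} to from to-cong from-cong to∘from from∘to = record
  { to        = to
  ; from      = from
  ; to-cong   = to-cong
  ; from-cong = from-cong
  ; inverse   = (λ {x} y≈ → Setoid.trans T (to-cong y≈) (to∘from x))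
              , (λ {x} y≈ → Setoid.trans S (from-cong y≈) (from∘to x))
  }

-- Equality ignores the witness of P, as `_≈_` on graphs ignores proofs; P may therefore carry data
-- such as a chosen fixed point.
Selfmaps : Pred (Fin n → Fin n) 0ℓ → Setoid 0ℓ 0ℓ
Selfmaps {n} P = On.setoid {B = Σ (Fin n → Fin n) P} (Fin n →-setoid Fin n) proj₁

record NearPerfect (f : Fin n → Fin n) : Set where
  field
    involutive   : Involutive _≡_ f
    unique-fixed : ∀ {x y} → f x ≡ x → f y ≡ y → x ≡ y

record OneFixed (f : Fin n → Fin n) : Set where
  field
    nearPerfect : NearPerfect f
    point       : Fin n
    fixed       : f point ≡ point
  open NearPerfect nearPerfect public

record Perfect (f : Fin n → Fin n) : Set where
  field
    involutive : Involutive _≡_ f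
    no-fixed   : ∀ x → f x ≢ x

-- Deleting and inserting a point

insert : Fin (suc n) → (Fin n → Fin n) → Fin (suc n) → Fin (suc n)
insert c g x = [ const c , (λ (y , _) → punchIn c (g y)) ] (punchIn-view c x)

insert-fixed : (c : Fin (suc n)) (g : Fin n → Fin n) → insert c g c ≡ c
insert-fixed c g with punchIn-view c c
... | inj₁ _ = refl
... | inj₂ (y , c≡) = contradiction (sym c≡) (punchInᵢ≢i c y)

insert-punchIn : (c : Fin (suc n)) (g : Fin n → Fin n) → ∀ y → insert c g (punchIn c y) ≡ punchIn c (g y)
insert-punchIn c g y with punchIn-view c (punchIn c y)
... | inj₁ ≡c = contradiction ≡c (punchInᵢ≢i c y)
... | inj₂ (y′ , y≡y′) = cong (punchIn c ∘ g) (sym (punchIn-injective c _ _ y≡y′))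

insert-cong : ∀ (c : Fin (suc n)) {g h} → g ≗ h → insert c g ≗ insert c h
insert-cong c g≗h x with punchIn-view c x
... | inj₁ _       = refl
... | inj₂ (y , _) = cong (punchIn c) (g≗h y)

insert-involutive : (c : Fin (suc n)) {g : Fin n → Fin n} → Involutive _≡_ g → Involutive _≡_ (insert c g)
insert-involutive c {g} inv x with punchIn-view c x
... | inj₁ refl = insert-fixed c g
... | inj₂ (y , refl) = trans (insert-punchIn c g (g y)) (cong (punchIn c) (inv y))

-- `remove c f` skips c: a point whose image under f is c becomes fixed.
remove : Fin (suc n) → (Fin (suc n) → Fin (suc n)) → Fin n → Fin n
remove c f y = [ const y , proj₁ ] (punchIn-view c (f (punchIn c y)))

remove-cong : ∀ (c : Fin (suc n)) {f g} → f ≗ g → remove c f ≗ remove c g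
remove-cong c f≗g y rewrite f≗g (punchIn c y) = refl

remove-unskipped : (c : Fin (suc n)) (f : Fin (suc n) → Fin (suc n)) →
  ∀ {y} → f (punchIn c y) ≢ c → punchIn c (remove c f y) ≡ f (punchIn c y)
remove-unskipped c f {y} fy≢c with punchIn-view c (f (punchIn c y))
... | inj₁ fy≡c = contradiction fy≡c fy≢c
... | inj₂ (_ , fy≡) = sym fy≡

remove-skipped : (c : Fin (suc n)) (f : Fin (suc n) → Fin (suc n)) →
  ∀ {y} → f (punchIn c y) ≡ c → remove c f y ≡ y
remove-skipped c f {y} fy≡c with punchIn-view c (f (punchIn c y))
... | inj₁ _ = refl
... | inj₂ (z , fy≡) = contradiction (trans (sym fy≡) fy≡c) (punchInᵢ≢i c z)

remove-insert : (c : Fin (suc n)) (g : Fin n → Fin n) → remove c (insert c g) ≗ g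
remove-insert c g y = punchIn-injective c _ _ (trans (remove-unskipped c (insert c g) λ ≡c →
  punchInᵢ≢i c (g y) (trans (sym (insert-punchIn c g y)) ≡c)) (insert-punchIn c g y))

module _ (c : Fin (suc n)) (f : Fin (suc n) → Fin (suc n)) (inv : Involutive _≡_ f) (fc≡c : f c ≡ c) where

  punchIn-remove : ∀ y → punchIn c (remove c f y) ≡ f (punchIn c y)
  punchIn-remove y = remove-unskipped c f λ fy≡c →
    punchInᵢ≢i c y (trans (sym (inv _)) (trans (cong f fy≡c) fc≡c))

  remove-involutive : Involutive _≡_ (remove c f)
  remove-involutive y = punchIn-injective c _ _ (trans (punchIn-remove _) (trans (cong f (punchIn-remove y)) (inv _)))

  remove-fixed : ∀ {y} → remove c f y ≡ y → f (punchIn c y) ≡ punchIn c y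
  remove-fixed eq = trans (sym (punchIn-remove _)) (cong (punchIn c) eq)

  insert-remove : insert c (remove c f) ≗ f
  insert-remove x with punchIn-view c x
  ... | inj₁ refl = sym fc≡c
  ... | inj₂ (y , refl) = punchIn-remove y

-- Since c is fixed, no other point maps to it, so `remove c` merely relabels; the exemption of c
-- from the fixed-point condition disappears together with c.
maximumMatching↔nearPerfect : (c : Fin (suc n)) → Inverse (Selfmaps (MaximumMatching c)) (Selfmaps (NearPerfect {n}))
maximumMatching↔nearPerfect c = mkInverse
  (λ (f , M) → let open MaximumMatching M in remove c f , record
    { involutive   = remove-involutive c f involutive avoids
    ; unique-fixed = λ fx fy → punchIn-injective c _ _ (maximum (punchInᵢ≢i c _) (punchInᵢ≢i c _)
        (remove-fixed c f involutive avoids fx) (remove-fixed c f involutive avoids fy))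
    })
  (λ (g , N) → let open NearPerfect N in insert c g , record
    { involutive = insert-involutive c involutive
    ; avoids     = insert-fixed c g
    ; maximum    = insert-maximum N
    })
  (remove-cong c)
  (insert-cong c)
  (λ (g , _) → remove-insert c g)
  (λ (f , M) → let open MaximumMatching M in insert-remove c f involutive avoids)
  where
  insert-maximum : ∀ {g} → NearPerfect g → ∀ {x y} → x ≢ c → y ≢ c →
                   insert c g x ≡ x → insert c g y ≡ y → x ≡ y
  insert-maximum {g} N {x} {y} x≢c y≢c fx fy with punchIn-view c x | punchIn-view c y
  ... | inj₁ x≡c | _ = contradiction x≡c x≢c
  ... | inj₂ _ | inj₁ y≡c = contradiction y≡c y≢c
  ... | inj₂ (_ , refl) | inj₂ (_ , refl) = cong (punchIn c)
    (NearPerfect.unique-fixed N (punchIn-injective c _ _ fx) (punchIn-injective c _ _ fy))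

-- The only fixed point may sit in any of `suc n` places, independently of the matching on the rest;
-- this is the odd factor in each step of the double factorial.
oneFixed↔fin×perfect : ∀ {n} → Inverse (Selfmaps (OneFixed {suc n}))
                                       (setoid (Fin (suc n)) ×ₛ Selfmaps (Perfect {n}))
oneFixed↔fin×perfect = mkInverse
  (λ (f , O) → let open OneFixed O in point , remove point f , record
    { involutive = remove-involutive point f involutive fixed
    ; no-fixed   = λ y ry≡y → punchInᵢ≢i point y (unique-fixed (remove-fixed point f involutive fixed ry≡y) fixed)
    })
  (λ (c , g , P) → insert c g , record
    { nearPerfect = record
      { involutive   = insert-involutive c (Perfect.involutive P)
      ; unique-fixed = λ fx fy → trans (fixed⇒≡ c P fx) (sym (fixed⇒≡ c P fy))
      }
    ; point = c
    ; fixed = insert-fixed c g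
    })
  (λ { {f , O} {f′ , O′} f≗f′ → to-cong O O′ f≗f′ })
  (λ { {c , _} (refl , g≗h) → insert-cong c g≗h })
  (λ (c , g , _) → refl , remove-insert c g)
  (λ (f , O) → let open OneFixed O in insert-remove point f involutive fixed)
  where
  fixed⇒≡ : ∀ c {g} → Perfect g → ∀ {x} → insert c g x ≡ x → x ≡ c
  fixed⇒≡ c P {x} fx with punchIn-view c x
  ... | inj₁ x≡c = x≡c
  ... | inj₂ (y , refl) = contradiction (punchIn-injective c _ _ fx) (Perfect.no-fixed P y)

  -- `point` is data that the setoid equality does not see; uniqueness of the fixed point makes it
  -- depend on the map alone.
  to-cong : ∀ {f f′} (O : OneFixed f) (O′ : OneFixed f′) → f ≗ f′ →
            OneFixed.point O ≡ OneFixed.point O′ × remove (OneFixed.point O) f ≗ remove (OneFixed.point O′) f′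
  to-cong {f} {f′} O O′ f≗f′ =
    p≡p′ , λ y → trans (remove-cong (OneFixed.point O) f≗f′ y) (cong (λ p → remove p f′ y) p≡p′)
    where
    p≡p′ = OneFixed.unique-fixed O′ (trans (sym (f≗f′ _)) (OneFixed.fixed O)) (OneFixed.fixed O′)

-- Inverse to `remove zero` when d is the only fixed point of g.
attach : Fin n → (Fin n → Fin n) → Fin (suc n) → Fin (suc n)
attach d g zero    = suc d
attach d g (suc y) with y ≟ d
... | yes _ = zero
... | no  _ = suc (g y)

attach-d : (d : Fin n) (g : Fin n → Fin n) → attach d g (suc d) ≡ zero
attach-d d g with d ≟ d
... | yes _ = refl
... | no d≢d = contradiction refl d≢d

attach-≢d : (d : Fin n) (g : Fin n → Fin n) → ∀ {y} → y ≢ d → attach d g (suc y) ≡ suc (g y)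
attach-≢d d g {y} y≢d with y ≟ d
... | yes y≡d = contradiction y≡d y≢d
... | no _ = refl

module _ {g : Fin n → Fin n} (O : OneFixed g) where
  open OneFixed O renaming (point to d)

  attach-perfect : Perfect (attach d g)
  attach-perfect = record { involutive = inv ; no-fixed = no-fixed }
    where
    inv : Involutive _≡_ (attach d g)
    inv zero    = attach-d d g
    inv (suc y) with y ≟ d
    ... | yes refl = refl
    ... | no  y≢d  = trans (attach-≢d d g λ gy≡d → y≢d (trans (sym (involutive y)) (trans (cong g gy≡d) fixed)))
                           (cong suc (involutive y))

    no-fixed : ∀ x → attach d g x ≢ x
    no-fixed (suc y) eq with y ≟ d
    ... | no y≢d = y≢d (unique-fixed (suc-injective eq) fixed)

  remove-attach : remove zero (attach d g) ≗ g
  remove-attach y with y ≟ d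
  ... | yes refl = sym fixed
  ... | no  _    = refl

attach-cong : ∀ {g h : Fin n → Fin n} (O : OneFixed g) (O′ : OneFixed h) → g ≗ h →
              attach (OneFixed.point O) g ≗ attach (OneFixed.point O′) h
attach-cong {g = g} {h} O O′ g≗h = λ where
    zero    → cong suc p≡p′
    (suc y) → helper y
  where
  open OneFixed
  p≡p′ : point O ≡ point O′
  p≡p′ = unique-fixed O′ (trans (sym (g≗h _)) (fixed O)) (fixed O′)

  helper : ∀ y → attach (point O) g (suc y) ≡ attach (point O′) h (suc y)
  helper y rewrite p≡p′ with y ≟ point O′
  ... | yes _ = refl
  ... | no  _ = cong suc (g≗h y)

module _ {f : Fin (suc (suc n)) → Fin (suc (suc n))} (P : Perfect f) where
  open Perfect P

  private
    mate : ∃ λ d → f zero ≡ suc d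
    mate with f zero in eq
    ... | zero  = contradiction eq (no-fixed zero)
    ... | suc d = d , refl

    d = proj₁ mate

    fd≡0 : f (suc d) ≡ zero
    fd≡0 = trans (cong f (sym (proj₂ mate))) (involutive zero)

    ≢d : ∀ {y} → y ≢ d → f (suc y) ≢ zero
    ≢d y≢d eq = y≢d (suc-injective (trans (sym (involutive _)) (trans (cong f eq) (proj₂ mate))))

    g = remove zero f

    g-≢d : ∀ {y} → y ≢ d → suc (g y) ≡ f (suc y)
    g-≢d y≢d = remove-unskipped zero f (≢d y≢d)

    gd≡d : g d ≡ d
    gd≡d = remove-skipped zero f fd≡0

    fixed⇒≡d : ∀ {y} → g y ≡ y → y ≡ d
    fixed⇒≡d {y} gy≡y with y ≟ d
    ... | yes y≡d = y≡d
    ... | no  y≢d = contradiction (trans (sym (g-≢d y≢d)) (cong suc gy≡y)) (no-fixed (suc y))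

    inv : Involutive _≡_ g
    inv y with y ≟ d
    ... | yes refl = trans (cong g gd≡d) gd≡d
    ... | no  y≢d  = suc-injective (trans (g-≢d gy≢d) (trans (cong f (g-≢d y≢d)) (involutive (suc y))))
      where
      -- If g sent y to d, then f would send `suc y` to `suc d`, whose mate is `zero`.
      gy≢d : g y ≢ d
      gy≢d gy≡d = case
        trans (sym (involutive (suc y))) (trans (cong f (trans (sym (g-≢d y≢d)) (cong suc gy≡d))) fd≡0)
        of λ ()

  -- Skipping `zero` cuts its 2-cycle and leaves its mate d fixed. All other points keep their
  -- images under f, so no further fixed point arises.
  detach : OneFixed (remove zero f)
  detach = record
    { nearPerfect = record
      { involutive   = inv
      ; unique-fixed = λ gx gy → trans (fixed⇒≡d gx) (sym (fixed⇒≡d gy))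
      }
    ; point = d
    ; fixed = gd≡d
    }

  attach-detach : attach (OneFixed.point detach) (remove zero f) ≗ f
  attach-detach zero    = sym (proj₂ mate)
  attach-detach (suc y) with y ≟ d
  ... | yes refl = sym fd≡0
  ... | no  y≢d  = g-≢d y≢d

-- Nothing is lost by deleting `zero`: the lone fixed point of the smaller map records which point
-- was its mate.
perfect↔oneFixed : ∀ {n} → Inverse (Selfmaps (Perfect {suc (suc n)})) (Selfmaps (OneFixed {suc n}))
perfect↔oneFixed = mkInverse
  (λ (f , P) → remove zero f , detach P)
  (λ (g , O) → attach (OneFixed.point O) g , attach-perfect O)
  (remove-cong zero)
  (λ { {g , O} {h , O′} g≗h → attach-cong O O′ g≗h })
  (λ (g , O) → remove-attach O)
  (λ (f , P) → attach-detach P)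

-- Double factorials and the number of maximum matchings

×-finite : ∀ {m n} → Inverse (setoid (Fin m) ×ₛ setoid (Fin n)) (setoid (Fin (m * n)))
×-finite {m} {n} = Compose.inverse Pointwise-≡↔≡ (Symmetry.inverse (*↔× {m} {n}))

-- k ‼ᵒ = (2k − 1)!!
_‼ᵒ : ℕ → ℕ
zero  ‼ᵒ = 1
suc k ‼ᵒ = suc (k * 2) * k ‼ᵒ

oneFixed-cardinality : ∀ {n k} → HasCardinality (Selfmaps (Perfect {n})) k →
                       HasCardinality (Selfmaps (OneFixed {suc n})) (suc n * k)
oneFixed-cardinality card = Compose.inverse oneFixed↔fin×perfect
  (Compose.inverse (Identity.inverse (setoid _) ×-inverse card) ×-finite)

perfect-cardinality : ∀ k → HasCardinality (Selfmaps (Perfect {k * 2})) (k ‼ᵒ)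
-- The empty map is the one perfect matching of no points.
perfect-cardinality zero    = mkInverse (const zero) (const ((λ ()) , record { involutive = λ () ; no-fixed = λ () }))
  (λ _ → refl) (λ { refl () }) (λ { zero → refl }) (λ _ ())
perfect-cardinality (suc k) = Compose.inverse perfect↔oneFixed (oneFixed-cardinality (perfect-cardinality k))

⌊k*2/2⌋≡k : ∀ k → ⌊ k * 2 /2⌋ ≡ k
⌊k*2/2⌋≡k zero    = refl
⌊k*2/2⌋≡k (suc k) = cong suc (⌊k*2/2⌋≡k k)

⌊1+k*2/2⌋≡k : ∀ k → ⌊ suc (k * 2) /2⌋ ≡ k
⌊1+k*2/2⌋≡k zero    = refl
⌊1+k*2/2⌋≡k (suc k) = cong suc (⌊1+k*2/2⌋≡k k)

halve : ∀ n → ∃ λ k → n ≡ k * 2 ⊎ n ≡ suc (k * 2)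
halve zero = 0 , inj₁ refl
halve (suc n) with halve n
... | k , inj₁ refl = k , inj₂ refl
... | k , inj₂ refl = suc k , inj₁ refl

even-fixed : ∀ k (f : Fin (k * 2) → Fin (k * 2)) → Involutive _≡_ f → count (Fixed? f) ≢ 1
even-fixed k f inv one = ℕ.even≢odd k e (begin
  2 * k                                          ≡⟨ ℕ.*-comm 2 k ⟩
  k * 2                                          ≡⟨ n≡2*excedances+fixed f inv ⟩
  e + e + count (Fixed? f)                       ≡⟨ cong (e + e +_) one ⟩
  e + e + 1                                      ≡⟨ lemma e ⟩
  suc (2 * e)                                    ∎)
  where
  open ≡-Reasoning
  e = excedances f
  lemma : ∀ e → e + e + 1 ≡ suc (2 * e)
  lemma = solve-∀

odd-fixed : ∀ k (f : Fin (suc (k * 2)) → Fin (suc (k * 2))) → Involutive _≡_ f → count (Fixed? f) ≢ 0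
odd-fixed k f inv none = ℕ.even≢odd e k (sym (begin
  suc (2 * k)                                    ≡⟨ cong suc (ℕ.*-comm 2 k) ⟩
  suc (k * 2)                                    ≡⟨ n≡2*excedances+fixed f inv ⟩
  e + e + count (Fixed? f)                       ≡⟨ cong (e + e +_) none ⟩
  e + e + 0                                      ≡⟨ lemma e ⟩
  2 * e                                          ∎))
  where
  open ≡-Reasoning
  e = excedances f
  lemma : ∀ e → e + e + 0 ≡ 2 * e
  lemma = solve-∀

Selfmaps-cong : {P Q : Pred (Fin n → Fin n) 0ℓ} → (∀ {f} → P f → Q f) → (∀ {f} → Q f → P f) →
                Inverse (Selfmaps P) (Selfmaps Q)
Selfmaps-cong P⇒Q Q⇒P = mkInverse (λ (f , p) → f , P⇒Q p) (λ (f , q) → f , Q⇒P q)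
  (λ eq → eq) (λ eq → eq) (λ _ _ → refl) (λ _ _ → refl)

-- Fixed points of an involution have the parity of the number of points, so here at most one means
-- none.
nearPerfect-even : ∀ k → HasCardinality (Selfmaps (NearPerfect {k * 2})) (k ‼ᵒ)
nearPerfect-even k = Compose.inverse (Selfmaps-cong to from) (perfect-cardinality k)
  where
  to : ∀ {f} → NearPerfect f → Perfect f
  to {f} N = record
    { involutive = involutive
    ; no-fixed   = λ x fx → even-fixed k f involutive
        (ℕ.≤-antisym (unique⇒count≤1 (Fixed? f) unique-fixed) (∃⇒count>0 (Fixed? f) fx))
    }
    where open NearPerfect N

  from : ∀ {f} → Perfect f → NearPerfect f
  from P = record { involutive = involutive ; unique-fixed = λ fx _ → contradiction fx (no-fixed _) }
    where open Perfect P

-- By parity a fixed point must exist; its 2k + 1 positions times (2k - 1)!! give (2k + 1)!!, which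
-- is `suc k ‼ᵒ`.
nearPerfect-odd : ∀ k → HasCardinality (Selfmaps (NearPerfect {suc (k * 2)})) (suc k ‼ᵒ)
nearPerfect-odd k = Compose.inverse (Selfmaps-cong to OneFixed.nearPerfect) (oneFixed-cardinality (perfect-cardinality k))
  where
  to : ∀ {f} → NearPerfect f → OneFixed f
  to {f} N = let p , fp = count≢0⇒∃ (Fixed? f) (odd-fixed k f (NearPerfect.involutive N)) in
    record { nearPerfect = N ; point = p ; fixed = fp }

-- The odd factors of (2k)! multiply to (2k - 1)!! and the even ones to 2^k k!; this is why the
-- division is exact.
[k*2]!≡ : ∀ k → (k * 2) ! ≡ k ‼ᵒ * (2 ^ k * k !)
[k*2]!≡ zero    = refl
[k*2]!≡ (suc k) = begin
  suc (suc (k * 2)) * (suc (k * 2) * (k * 2) !)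
    ≡⟨ cong (λ m → suc (suc (k * 2)) * (suc (k * 2) * m)) ([k*2]!≡ k) ⟩
  suc (suc (k * 2)) * (suc (k * 2) * (k ‼ᵒ * (2 ^ k * k !)))      ≡⟨ lemma k (k ‼ᵒ) (2 ^ k) (k !) ⟩
  suc (k * 2) * k ‼ᵒ * (2 * 2 ^ k * (suc k * k !))                ∎
  where
  open ≡-Reasoning
  lemma : ∀ k d p q → suc (suc (k * 2)) * (suc (k * 2) * (d * (p * q))) ≡ suc (k * 2) * d * (2 * p * (suc k * q))
  lemma = solve-∀

matchingNumber : ℕ → ℕ
matchingNumber n = _/_ (n !) (2 ^ ⌊ n /2⌋ * ⌊ n /2⌋ !) {{2^k*k!≢0 ⌊ n /2⌋}}

matchingNumber-even : ∀ k → matchingNumber (k * 2) ≡ k ‼ᵒ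
matchingNumber-even k rewrite ⌊k*2/2⌋≡k k | [k*2]!≡ k = m*n/n≡m (k ‼ᵒ) (2 ^ k * k !) {{2^k*k!≢0 k}}

-- The divisor is still 2^k k!, so the extra factor 2k + 1 of the factorial passes to the quotient.
matchingNumber-odd : ∀ k → matchingNumber (suc (k * 2)) ≡ suc k ‼ᵒ
matchingNumber-odd k rewrite ⌊1+k*2/2⌋≡k k | [k*2]!≡ k | sym (ℕ.*-assoc (suc (k * 2)) (k ‼ᵒ) (2 ^ k * k !)) =
  m*n/n≡m (suc k ‼ᵒ) (2 ^ k * k !) {{2^k*k!≢0 k}}

nearPerfect-cardinality : ∀ n → HasCardinality (Selfmaps (NearPerfect {n})) (matchingNumber n)
nearPerfect-cardinality n with halve n
... | k , inj₁ refl = subst (HasCardinality _) (sym (matchingNumber-even k)) (nearPerfect-even k)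
... | k , inj₂ refl = subst (HasCardinality _) (sym (matchingNumber-odd k)) (nearPerfect-odd k)

maximumMatching-cardinality : (c : Fin (suc n)) → HasCardinality (Selfmaps (MaximumMatching c)) (matchingNumber n)
maximumMatching-cardinality c = Compose.inverse (maximumMatching↔nearPerfect c) (nearPerfect-cardinality _)

-- Independent choices for all heads

Families : ∀ {n} → (Fin n → Setoid 0ℓ 0ℓ) → Setoid 0ℓ 0ℓ
Families S = record
  { Carrier       = ∀ i → Setoid.Carrier (S i)
  ; _≈_           = λ F G → ∀ i → Setoid._≈_ (S i) (F i) (G i)
  ; isEquivalence = record
    { refl  = λ i → Setoid.refl (S i)
    ; sym   = λ p i → Setoid.sym (S i) (p i)
    ; trans = λ p q i → Setoid.trans (S i) (p i) (q i)
    }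
  }

funToFin-cong : ∀ {m n} {f g : Fin m → Fin n} → f ≗ g → funToFin f ≡ funToFin g
funToFin-cong {zero}  f≗g = refl
funToFin-cong {suc m} f≗g = cong₂ combine (f≗g zero) (funToFin-cong (f≗g ∘ suc))

families-cardinality : ∀ {n k} (S : Fin n → Setoid 0ℓ 0ℓ) → (∀ i → HasCardinality (S i) k) →
                       HasCardinality (Families S) (k ^ n)
families-cardinality {n} {k} S card = mkInverse
  (λ F → funToFin (λ i → to (card i) (F i)))
  (λ j i → from (card i) (finToFun j i))
  (λ F≈G → funToFin-cong λ i → to-cong (card i) (F≈G i))
  (λ { refl i → Setoid.refl (S i) })
  (λ j → trans (funToFin-cong λ i → strictlyInverseˡ (card i) (finToFun j i)) (funToFin-finToFin {n} {k} j))
  (λ F i → Setoid.trans (S i) (from-cong (card i) (finToFun-funToFin _ i)) (strictlyInverseʳ (card i) (F i)))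
  where open Inverse

-- Oriented families of maximum matchings

-- A general vertex type A allows vertices to be pairs or a point at infinity. With b = `mate c a`,
-- the field `oriented` excludes a second edge ac→b on the triple; excluding bc→a is the same
-- condition with a and b exchanged.
record OrientedMatchings (A : Set) : Set where
  field
    mate       : A → A → A
    involutive : ∀ c → Involutive _≡_ (mate c)
    avoids     : ∀ c → mate c c ≡ c
    maximum    : ∀ c {x y} → x ≢ c → y ≢ c → mate c x ≡ x → mate c y ≡ y → x ≡ y
    oriented   : ∀ c a → a ≢ mate c a → mate (mate c a) a ≢ c

transport : A ↔ B → OrientedMatchings A → OrientedMatchings B
transport {A} {B} A↔B M = record
  { mate       = mate′
  ; involutive = λ c x → trans
      (cong to (trans (cong (mate (from c)) (strictlyInverseʳ _)) (involutive (from c) (from x))))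
      (strictlyInverseˡ x)
  ; avoids     = λ c → trans (cong to (avoids (from c))) (strictlyInverseˡ c)
  ; maximum    = λ c x≢c y≢c fx fy → from-injective (maximum (from c)
      (x≢c ∘ from-injective) (y≢c ∘ from-injective) (from-mate fx) (from-mate fy))
  ; oriented   = λ c a a≢ eq → oriented (from c) (from a)
                   (λ fa≡ → a≢ (trans (sym (strictlyInverseˡ a)) (cong to fa≡)))
                   (trans (cong (λ z → mate z (from a)) (sym (strictlyInverseʳ _))) (from-mate eq))
  }
  where
  open Inverse A↔B
  open OrientedMatchings M
  mate′ : B → B → B
  mate′ c a = to (mate (from c) (from a))

  from-injective : ∀ {x y} → from x ≡ from y → x ≡ y
  from-injective = Injection.injective (Inverse⇒Injection (Symmetry.inverse A↔B))

  from-mate : ∀ {c x y} → mate′ c x ≡ y → mate (from c) (from x) ≡ from y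
  from-mate eq = trans (sym (strictlyInverseʳ _)) (cong from eq)

-- All heads share the perfect matching {(i , false) , (i , true)}.
module Even (m : ℕ) where

  V : Set
  V = Fin m × Bool

  mate : V → V → V
  mate (i , _) (j , t) with j ≟ i
  ... | yes _ = j , t
  ... | no  _ = j , not t

  mate-≡ : ∀ i s {t} → mate (i , s) (i , t) ≡ (i , t)
  mate-≡ i _ with i ≟ i
  ... | yes _  = refl
  ... | no i≢i = contradiction refl i≢i

  mate-≢ : ∀ {i j} s t → j ≢ i → mate (i , s) (j , t) ≡ (j , not t)
  mate-≢ {i} {j} s t j≢i with j ≟ i
  ... | yes j≡i = contradiction j≡i j≢i
  ... | no _    = refl

  mate-inv : ∀ c → Involutive _≡_ (mate c)
  mate-inv (i , s) (j , t) with j ≟ i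
  ... | yes refl = mate-≡ i s
  ... | no  j≢i  = trans (mate-≢ s (not t) j≢i) (cong (j ,_) (not-involutive t))

  mate-fixed : ∀ c {x} → x ≢ c → mate c x ≡ x → x ≡ (proj₁ c , not (proj₂ c))
  mate-fixed (i , s) {j , t} x≢c fx with j ≟ i
  ... | yes refl = cong (j ,_) (¬-not (x≢c ∘ cong (j ,_)))
  ... | no  j≢i  = contradiction (cong proj₂ (sym fx)) (not-¬ refl)

  -- The vertex `mate c a` is the twin of a, and as a head it leaves a unmatched.
  mate-oriented : ∀ c a → a ≢ mate c a → mate (mate c a) a ≢ c
  mate-oriented (i , s) (j , t) a≢ eq with j ≟ i
  ... | yes _   = a≢ refl
  ... | no  j≢i = j≢i (cong proj₁ (trans (sym (mate-≡ j (not t))) eq))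

  matchings : OrientedMatchings V
  matchings = record
    { mate       = mate
    ; involutive = mate-inv
    ; avoids     = λ (i , s) → mate-≡ i s
    ; maximum    = λ c x≢c y≢c fx fy → trans (mate-fixed c x≢c fx) (sym (mate-fixed c y≢c fy))
    ; oriented   = mate-oriented
    }

-- `next true` and `next false` are the two directions of a cyclic order of the pairs. Being
-- mutually inverse, without fixed points and without 2-cycles is what keeps the rematched edges
-- from sharing a triple.
module Odd {m : ℕ} (next : Bool → Fin m → Fin m)
           (next-cancel : ∀ {s t} i → t ≢ s → next t (next s i) ≡ i)
           (next≢ : ∀ s {i} → next s i ≢ i)
           (next²≢ : ∀ s {i} → next s (next s i) ≢ i) where

  V : Set
  V = ⊤ ⊎ Fin m × Bool

  pattern ∞ = inj₁ tt

  -- The pairs {(i , false) , (i , true)} are a perfect matching of V ∖ ∞; the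
  -- head (i , s) rematches its own pair, the pair of next s i, and ∞.
  mate : V → V → V
  mate ∞         ∞         = ∞
  mate ∞         (inj₂ (j , t)) = inj₂ (j , not t)
  mate (inj₂ (i , s)) ∞         = inj₂ (next s i , s)
  mate (inj₂ (i , s)) (inj₂ (j , t)) with j ≟ i | j ≟ next s i | t ≟ᵇ s
  ... | yes _ | _     | yes _ = inj₂ (i , s)
  ... | yes _ | _     | no  _ = inj₂ (next s i , t)
  ... | no  _ | yes _ | yes _ = ∞
  ... | no  _ | yes _ | no  _ = inj₂ (i , t)
  ... | no  _ | no  _ | _     = inj₂ (j , not t)

  mate-self : ∀ i s → mate (inj₂ (i , s)) (inj₂ (i , s)) ≡ inj₂ (i , s)
  mate-self i s with i ≟ i | i ≟ next s i | s ≟ᵇ s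
  ... | no i≢i | _ | _      = contradiction refl i≢i
  ... | yes _  | _ | yes _  = refl
  ... | yes _  | _ | no s≢s = contradiction refl s≢s

  mate-twin : ∀ i {s t} → t ≢ s → mate (inj₂ (i , s)) (inj₂ (i , t)) ≡ inj₂ (next s i , t)
  mate-twin i {s} {t} t≢s with i ≟ i | i ≟ next s i | t ≟ᵇ s
  ... | no i≢i | _ | _       = contradiction refl i≢i
  ... | yes _  | _ | yes t≡s = contradiction t≡s t≢s
  ... | yes _  | _ | no _    = refl

  mate-next : ∀ i s → mate (inj₂ (i , s)) (inj₂ (next s i , s)) ≡ ∞
  mate-next i s with next s i ≟ i | next s i ≟ next s i | s ≟ᵇ s
  ... | yes n≡i | _      | _      = contradiction n≡i (next≢ s)
  ... | no _    | no n≢n | _      = contradiction refl n≢n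
  ... | no _    | yes _  | yes _  = refl
  ... | no _    | yes _  | no s≢s = contradiction refl s≢s

  mate-next-twin : ∀ i {s t} → t ≢ s → mate (inj₂ (i , s)) (inj₂ (next s i , t)) ≡ inj₂ (i , t)
  mate-next-twin i {s} {t} t≢s with next s i ≟ i | next s i ≟ next s i | t ≟ᵇ s
  ... | yes n≡i | _      | _       = contradiction n≡i (next≢ s)
  ... | no _    | no n≢n | _       = contradiction refl n≢n
  ... | no _    | yes _  | yes t≡s = contradiction t≡s t≢s
  ... | no _    | yes _  | no _    = refl

  mate-other : ∀ {i j} s t → j ≢ i → j ≢ next s i → mate (inj₂ (i , s)) (inj₂ (j , t)) ≡ inj₂ (j , not t)
  mate-other {i} {j} s t j≢i j≢n with j ≟ i | j ≟ next s i
  ... | yes j≡i | _       = contradiction j≡i j≢i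
  ... | no _    | yes j≡n = contradiction j≡n j≢n
  ... | no _    | no _    = refl

  mate-inv : ∀ c → Involutive _≡_ (mate c)
  mate-inv ∞         ∞         = refl
  mate-inv ∞         (inj₂ (j , t)) = cong (λ t → inj₂ (j , t)) (not-involutive t)
  mate-inv (inj₂ (i , s)) ∞         = mate-next i s
  mate-inv (inj₂ (i , s)) (inj₂ (j , t)) with j ≟ i | j ≟ next s i | t ≟ᵇ s
  ... | yes refl | _        | yes refl = mate-self i s
  ... | yes refl | _        | no  t≢s  = mate-next-twin i t≢s
  ... | no  _    | yes refl | yes refl = refl
  ... | no  _    | yes refl | no  t≢s  = mate-twin i t≢s
  ... | no  j≢i  | no  j≢n  | _        =
    trans (mate-other s (not t) j≢i j≢n) (cong (λ t → inj₂ (j , t)) (not-involutive t))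

  mate-avoids : ∀ c → mate c c ≡ c
  mate-avoids ∞         = refl
  mate-avoids (inj₂ (i , s)) = mate-self i s

  mate-fixed : ∀ c x → mate c x ≡ x → x ≡ c
  mate-fixed ∞              ∞              _  = refl
  mate-fixed ∞              (inj₂ (j , t)) fx = contradiction (cong proj₂ (inj₂-injective (sym fx))) (not-¬ refl)
  mate-fixed (inj₂ (i , s)) (inj₂ (j , t)) fx with j ≟ i | j ≟ next s i | t ≟ᵇ s
  ... | yes refl | _     | yes refl = refl
  ... | yes refl | _     | no _     = contradiction (cong proj₁ (inj₂-injective fx)) (next≢ s)
  ... | no j≢i   | yes _ | no _     = contradiction (cong proj₁ (inj₂-injective (sym fx))) j≢i
  ... | no _     | no _  | _        = contradiction (cong proj₂ (inj₂-injective (sym fx))) (not-¬ refl)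

  -- If the two neighbours of i coincided, two steps in the same direction would lead back to i.
  next-split : ∀ {s t} i → t ≢ s → next s i ≢ next t i
  next-split {s} {t} i t≢s eq = next²≢ s (trans (cong (next s) eq) (next-cancel i (t≢s ∘ sym)))

  mate-oriented : ∀ c a → a ≢ mate c a → mate (mate c a) a ≢ c
  mate-oriented ∞              ∞              a≢ = contradiction refl a≢
  mate-oriented ∞              (inj₂ (j , t)) _ eq =
    case trans (sym (mate-twin j (not-¬ {t} refl))) eq of λ ()
  -- A second edge on the triple of ∞, c and `next s i` would make i the next but one of itself.
  mate-oriented (inj₂ (i , s)) ∞              _ eq = next²≢ s (cong proj₁ (inj₂-injective eq))
  mate-oriented (inj₂ (i , s)) (inj₂ (j , t)) a≢ eq with j ≟ i | j ≟ next s i | t ≟ᵇ s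
  ... | yes refl | _        | yes refl = a≢ refl
  -- As `next t` undoes `next s`, the head (next s i , t) borrows from pair i, so it matches (i , t)
  -- with ∞ and not with c.
  ... | yes refl | _        | no  t≢s  = case
    trans (sym (trans
      (cong (λ k → mate (inj₂ (next s i , t)) (inj₂ (k , t))) (sym (next-cancel i t≢s)))
      (mate-next (next s i) t))) eq
    of λ ()
  ... | no  _    | yes refl | yes refl = not-¬ refl (sym (cong proj₂ (inj₂-injective eq)))
  ... | no  _    | yes refl | no  t≢s  = next≢ s (cong proj₁ (inj₂-injective
    (trans (sym (mate-other t t (next≢ s) (next-split i t≢s))) eq)))
  -- The head (j , not t) matches its twin (j , t) with (next (not t) j , t). If that is c, then s =
  -- t and j = next s i, the pair excluded here.
  ... | no  _    | no  j≢n  | _        with trans (sym (mate-twin j (not-¬ {t} refl))) eq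
  ...   | refl = j≢n (sym (next-cancel j (not-¬ refl)))

  matchings : OrientedMatchings V
  matchings = record
    { mate       = mate
    ; involutive = mate-inv
    ; avoids     = mate-avoids
    ; maximum    = λ c x≢c _ fx _ → contradiction (mate-fixed c _ fx) x≢c
    ; oriented   = mate-oriented
    }

-- Cyclic shift of `Fin`

rotate : Fin (suc n) → Fin (suc n)
rotate i with view i
... | ‵fromℕ     = zero
... | ‵inject₁ j = suc j

rotate⁻¹ : Fin (suc n) → Fin (suc n)
rotate⁻¹ zero    = fromℕ _
rotate⁻¹ (suc j) = inject₁ j

rotate-rotate⁻¹ : (i : Fin (suc n)) → rotate (rotate⁻¹ i) ≡ i
rotate-rotate⁻¹ {n} zero rewrite view-fromℕ n = refl
rotate-rotate⁻¹ (suc j) rewrite view-inject₁ j = refl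

rotate⁻¹-rotate : (i : Fin (suc n)) → rotate⁻¹ (rotate i) ≡ i
rotate⁻¹-rotate i with view i
... | ‵fromℕ     = refl
... | ‵inject₁ j = refl

rotate≢ : (i : Fin (2 + n)) → rotate i ≢ i
rotate≢ i eq with view i
... | ‵inject₁ j = contradiction (trans (cong toℕ eq) (toℕ-inject₁ j)) ℕ.1+n≢n

-- On a cycle of at least three points predecessor and successor differ: away from the wrap-around
-- they are k and k + 2.
rotate²≢ : (i : Fin (3 + n)) → rotate (rotate i) ≢ i
rotate²≢ i eq = rotate⁻¹≢rotate i (trans (cong rotate⁻¹ (sym eq)) (rotate⁻¹-rotate _))
  where
  rotate⁻¹≢rotate : (i : Fin (3 + n)) → rotate⁻¹ i ≢ rotate i
  rotate⁻¹≢rotate (suc j) eq with view j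
  ... | ‵inject₁ k = contradiction
    (sym (trans (sym (trans (toℕ-inject₁ (inject₁ k)) (toℕ-inject₁ k))) (cong toℕ eq)))
    (ℕ.m+1+n≢n 1)

next : Bool → Fin (suc n) → Fin (suc n)
next true  = rotate
next false = rotate⁻¹

next-cancel : ∀ {s t} (i : Fin (suc n)) → t ≢ s → next t (next s i) ≡ i
next-cancel {s = true}  {true}  i t≢s = contradiction refl t≢s
next-cancel {s = true}  {false} i t≢s = rotate⁻¹-rotate i
next-cancel {s = false} {true}  i t≢s = rotate-rotate⁻¹ i
next-cancel {s = false} {false} i t≢s = contradiction refl t≢s

next≢ : ∀ s {i : Fin (2 + n)} → next s i ≢ i
next≢ true  {i} eq = rotate≢ i eq
next≢ false {i} eq = rotate≢ i (trans (cong rotate (sym eq)) (rotate-rotate⁻¹ i))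

next²≢ : ∀ s {i : Fin (3 + n)} → next s (next s i) ≢ i
next²≢ true  {i} eq = rotate²≢ i eq
next²≢ false {i} eq = rotate²≢ i (trans (cong (rotate ∘ rotate) (sym eq))
  (trans (cong rotate (rotate-rotate⁻¹ (rotate⁻¹ i))) (rotate-rotate⁻¹ i)))

-- The head c is matched along a + b = 2c in ℤ/5.
orientedMatchings₅ : OrientedMatchings (Fin 5)
orientedMatchings₅ = record
  { mate       = mate
  ; involutive = from-yes (all? λ c → all? λ x → mate c (mate c x) ≟ x)
  ; avoids     = from-yes (all? λ c → mate c c ≟ c)
  ; maximum    = λ c x≢c _ fx _ → contradiction (mate-fixed c _ fx) x≢c
  -- From a + b = 2c and a + c = 2b follows 3b = 3c, hence b = c and then a = b; 3 is invertible
  -- modulo 5.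
  ; oriented   = from-yes (all? λ c → all? λ a → ¬? (a ≟ mate c a) →-dec ¬? (mate (mate c a) a ≟ c))
  }
  where
  mate : Fin 5 → Fin 5 → Fin 5
  -- The coefficient 4 is -1 modulo 5.
  mate c a = (2 * toℕ c + 4 * toℕ a) mod 5

  mate-fixed : ∀ c x → mate c x ≡ x → x ≡ c
  mate-fixed = from-yes (all? λ c → all? λ x → (mate c x ≟ x) →-dec (x ≟ c))

pairs↔ : ∀ m → (Fin m × Bool) ↔ Fin (m * 2)
pairs↔ m = Compose.inverse (Identity.inverse _ ×-↔ Symmetry.inverse 2↔Bool) (Symmetry.inverse *↔×)

orientedMatchings : ∀ n → 4 ≤ n → OrientedMatchings (Fin n)
orientedMatchings n 4≤n with halve n
... | m , inj₁ refl = transport (pairs↔ m) (Even.matchings m)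
... | 0 , inj₂ refl = contradiction 4≤n λ { (s≤s ()) }
-- n = 3 is a true exception: its three heads need one edge each, all on the single triple.
... | 1 , inj₂ refl = contradiction 4≤n λ { (s≤s (s≤s (s≤s ()))) }
-- With two pairs the cyclic shift has order 2, so `next²≢` fails.
... | 2 , inj₂ refl = orientedMatchings₅
... | m@(suc (suc (suc _))) , inj₂ refl =
  transport (Compose.inverse (Symmetry.inverse 1↔⊤ ⊎-↔ pairs↔ m) (Symmetry.inverse +↔⊎))
            (Odd.matchings next next-cancel next≢ next²≢)

-- Extremal graphs

MaximumMatching-resp-≗ : {c : Fin n} {f g : Fin n → Fin n} → f ≗ g → MaximumMatching c f → MaximumMatching c g
MaximumMatching-resp-≗ {f = f} {g} f≗g M = record
  { involutive = λ x → trans (sym (f≗g (g x))) (trans (cong f (sym (f≗g x))) (involutive x))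
  ; avoids     = trans (sym (f≗g _)) avoids
  ; maximum    = λ x≢c y≢c gx gy → maximum x≢c y≢c (trans (f≗g _) gx) (trans (f≗g _) gy)
  }
  where open MaximumMatching M

module FromMaximum {n : ℕ} (F : Fin (suc n) → Fin (suc n) → Fin (suc n))
                   (F-max : ∀ c → MaximumMatching c (F c)) where

  open MaximumMatching

  private
    F-involutive : ∀ c → Involutive _≡_ (F c)
    F-involutive c = involutive (F-max c)

    F-avoids : ∀ c → F c c ≡ c
    F-avoids c = avoids (F-max c)

  graph : DiHypergraph (suc n)
  graph = fromLinks F F-involutive F-avoids

  graph-links : MatchingLinks graph
  graph-links = fromLinks-matchingLinks F F-involutive F-avoids

  graph-partner : ∀ c → partner graph c ≗ F c
  graph-partner = partner-fromLinks F F-involutive F-avoids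

  graph-free : graph IsFreeOf I₁
  graph-free = matchingLinks⇒I₁-free graph graph-links

  graph-edgeCount : edgeCount graph ≡ suc n * ⌊ n /2⌋
  graph-edgeCount = maximum⇒edgeCount≡ graph graph-links λ c →
    MaximumMatching-resp-≗ (λ x → sym (graph-partner c x)) (F-max c)

free⇒edgeCount≤ : (G : DiHypergraph (suc n)) → G IsFreeOf I₁ → edgeCount G ≤ suc n * ⌊ n /2⌋
free⇒edgeCount≤ G free = edgeCount≤ G (I₁-free⇒matchingLinks G free)

orientedExtremal : ∀ n → 4 ≤ suc n →
  ∃ λ (G : DiHypergraph (suc n)) → (Oriented G × G IsFreeOf I₁) × edgeCount G ≡ suc n * ⌊ n /2⌋
orientedExtremal n 4≤1+n = graph , (graph-oriented , graph-free) , graph-edgeCount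
  where
  open OrientedMatchings (orientedMatchings (suc n) 4≤1+n)

  mate-maximum : ∀ c → MaximumMatching c (mate c)
  mate-maximum c = record { involutive = involutive c ; avoids = avoids c ; maximum = maximum c }

  open FromMaximum mate mate-maximum

  graph-oriented : Oriented graph
  graph-oriented a b c ab→c with fromLinks-edge mate involutive avoids ab→c
  ... | refl , a≢b =
    (λ ac→b → oriented c a a≢b (proj₁ (fromLinks-edge mate involutive avoids ac→b))) ,
    -- The field `oriented` is applied at b, whose mate under c is a by involutivity.
    (λ bc→a → oriented c b (λ b≡ → a≢b (sym (trans b≡ (involutive c a))))
                (subst (λ z → mate z b ≡ c) (sym (involutive c a))
                  (proj₁ (fromLinks-edge mate involutive avoids bc→a))))

-- The hypothesis serves both directions: its witness G₀ forces every extremal graph up to the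
-- bound, and it certifies the graphs built from families as extremal.
extremalGraphs↔families : ∀ n → Ex (suc n) I₁ (suc n * ⌊ n /2⌋) →
  Inverse (extremalGraphs (suc n) I₁) (Families {suc n} λ c → Selfmaps (MaximumMatching c))
extremalGraphs↔families n ex@((G₀ , G₀-free , G₀-edgeCount) , _) = mkInverse
  (λ (G , ext) c → partner G c , edgeCount≡⇒maximum G (links G ext) (extremal-edgeCount G ext) c)
  (λ F → let open FromMaximum (λ c → proj₁ (F c)) (λ c → proj₂ (F c)) in
    graph , graph-free , subst (Ex (suc n) I₁) (sym graph-edgeCount) ex)
  (λ { {G , ext} {H , ext′} → partner-cong {G} {H} (links G ext) (links H ext′) })
  -- `edge?` of the built graph uses the family only through the value at c and a, so pointwise
  -- equality suffices.
  (λ F≗F′ a b c → cong (λ z → ⌊ (z ≟ b) ×-dec ¬? (a ≟ b) ⌋) (F≗F′ c a))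
  (λ F c → FromMaximum.graph-partner (λ c → proj₁ (F c)) (λ c → proj₂ (F c)) c)
  (λ (G , ext) → fromLinks-partner G (links G ext))
  where
  links : ∀ G → IsExtremal I₁ G → MatchingLinks G
  links G (free , _) = I₁-free⇒matchingLinks G free

  extremal-edgeCount : ∀ G → IsExtremal I₁ G → edgeCount G ≡ suc n * ⌊ n /2⌋
  extremal-edgeCount G (free , _ , max) = ℕ.≤-antisym (free⇒edgeCount≤ G free)
    (subst (_≤ edgeCount G) G₀-edgeCount (max G₀ G₀-free))

  partner-cong : ∀ {G H} → MatchingLinks G → MatchingLinks H → G ≈ H → ∀ c → partner G c ≗ partner H c
  partner-cong {G} {H} G-links H-links G≈H c a with partner G c a ≟ a | partner H c a ≟ a
  ... | no  p≢a | _       = sym (edge⇒partner≡ H H-links (subst T (G≈H a _ c) (partner≢⇒edge G p≢a)))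
  ... | yes p≡a | yes q≡a = trans p≡a (sym q≡a)
  ... | yes _   | no  q≢a = edge⇒partner≡ G G-links (subst T (sym (G≈H a _ c)) (partner≢⇒edge H q≢a))

theorem3p1 : (n : ℕ) → 4 ≤ n →
    Ex n I₁ (n * ⌊ n ∸ 1 /2⌋)
    × Exₒ n I₁ (n * ⌊ n ∸ 1 /2⌋)
    × HasCardinality (extremalGraphs n I₁)
    ((_/_ ((n ∸ 1) !) (2 ^ ⌊ n ∸ 1 /2⌋ * ⌊ n ∸ 1 /2⌋ !) {{2^k*k!≢0 ⌊ n ∸ 1 /2⌋}}) ^ n)
theorem3p1 (suc n) 4≤1+n = ex , exₒ , card
  where
  ex : Ex (suc n) I₁ (suc n * ⌊ n /2⌋)
  ex = let G , (_ , free) , eq = orientedExtremal n 4≤1+n in (G , free , eq) , free⇒edgeCount≤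

  exₒ : Exₒ (suc n) I₁ (suc n * ⌊ n /2⌋)
  exₒ = orientedExtremal n 4≤1+n , λ G (_ , free) → free⇒edgeCount≤ G free

  card : HasCardinality (extremalGraphs (suc n) I₁) (matchingNumber n ^ suc n)
  card = Compose.inverse (extremalGraphs↔families n ex) (families-cardinality _ maximumMatching-cardinality)
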